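{- For every finite graph $G$ and every integer $k$ with $1\le k<|V(G)|$, the graphs $C(F_k(G))$ and $F_k(C(G))$, both of which have as vertex set the set of $k$-element subsets of $V(G)$, are equal: $C(F_k(G))=F_k(C(G))$.
   Context: All graphs are finite, simple and undirected; edges are regarded as 2-element subsets of the vertex set, and $N_G(u)$ denotes the set of neighbors of $u$ in $G$. For a graph $G$ and an integer $k$ with $1\le k<|V(G)|$, the $k$-token graph $F_k(G)$ is the graph whose vertices are the $k$-element subsets of $V(G)$, with two such subsets $A,B$ adjacent if and only if their symmetric difference $A\triangle B$ is an edge of $G$ (in particular $|A\triangle B|=2$). For any graph $G$, a pair $\{u,v\}$ of distinct vertices of $G$ is called admissible if $|N_G(u)\cap N_G(v)|\ge 5$; $A(G)$ denotes the set of all admissible pairs of $G$. The admissible augmentation of $G$ is the graph $C(G)=(V(G),E(G)\cup A(G))$. -}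

module Defs where

open import Data.Bool as Bool using ()
open import Data.Empty using (⊥)
open import Data.Fin using (Fin)
open import Data.Fin.Properties using (any?; inj⇒≟; +↔⊎; 0↔⊥; 1↔⊤)
open import Data.Fin.Subset using (Subset; inside; outside; ⁅_⁆; _∪_; _∩_; _─_; ∣_∣; _∈_)
open import Data.Fin.Subset.Properties using (∪-comm; ∩-comm; x∈p∪q⁺; x∈⁅x⁆)
open import Data.Irrelevant using ([_])
open import Data.Nat using (ℕ; zero; suc; _+_; _≤_; _≤?_)
open import Data.Nat.Properties using (suc-injective)
open import Data.Product using (∃; ∃₂; _×_; _,_; proj₁; proj₂)
open import Data.Refinement using (Refinement-syntax; _,_; value)
open import Data.Sum using (_⊎_; inj₁; inj₂)
open import Data.Sum.Function.Propositional using (_⊎-↔_)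
open import Data.Unit using (⊤; tt)
open import Data.Vec using ([]; _∷_; tabulate; there)
open import Data.Vec.Properties using (≡-dec)
open import Function using (_↔_; _⇔_; Inverse; mk↔ₛ′)
open import Function.Construct.Composition using (_↔-∘_)
open import Function.Construct.Symmetry using (↔-sym)
open import Function.Properties.Inverse using (↔⇒↣)
open import Level using (Level; _⊔_) renaming (suc to lsuc)
open import Relation.Binary.Definitions using (Decidable; DecidableEquality; Irreflexive; Symmetric)
open import Relation.Binary.PropositionalEquality using (_≡_; _≢_; refl; sym; cong; subst)
open import Relation.Nullary using (Dec; does; ¬?; map′; _×-dec_; _⊎-dec_)
open import Relation.Unary using (Pred) renaming (Decidable to Decidable₁)

record FiniteSet (a : Level) : Set (lsuc a) where
  field
    Carrier : Set a
    size    : ℕ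
    finite  : Carrier ↔ Fin size

  open Inverse finite public
    using () renaming (to to index; from to element; strictlyInverseʳ to element-index)

  infix 4 _≟_
  _≟_ : DecidableEquality Carrier
  _≟_ = inj⇒≟ (↔⇒↣ finite)

  ∃? : ∀ {p} {P : Pred Carrier p} → Decidable₁ P → Dec (∃ P)
  ∃? {P = P} P? = map′
    (λ (i , Pi) → element i , Pi)
    (λ (x , Px) → index x , subst P (sym (element-index x)) Px)
    (any? (λ i → P? (element i)))

-- Subsets of a finite set X are represented by subsets of its index set.

module _ {a : Level} (X : FiniteSet a) where
  open FiniteSet X

  SubsetOf : Set
  SubsetOf = Subset size

  ⟦_⟧ : ∀ {p} {P : Pred Carrier p} → Decidable₁ P → SubsetOf
  ⟦ P? ⟧ = tabulate (λ i → does (P? (element i)))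

  pair : Carrier → Carrier → SubsetOf
  pair x y = ⁅ index x ⁆ ∪ ⁅ index y ⁆

infixl 6 _△_
_△_ : ∀ {n} → Subset n → Subset n → Subset n
p △ q = (p ─ q) ∪ (q ─ p)

△-comm : ∀ {n} (p q : Subset n) → p △ q ≡ q △ p
△-comm p q = ∪-comm (p ─ q) (q ─ p)

p△p-empty : ∀ {n} (p : Subset n) {x : Fin n} → x ∈ p △ p → ⊥
p△p-empty (inside  ∷ p) (there x∈) = p△p-empty p x∈
p△p-empty (outside ∷ p) (there x∈) = p△p-empty p x∈

-- The size proof is irrelevant, so two k-subsets are equal as soon as the
-- underlying subsets are.

KSubset : ℕ → ℕ → Set
KSubset n k = [ p ∈ Subset n ∣ ∣ p ∣ ≡ k ]

private
  zero-zero : KSubset 0 0 ↔ ⊤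
  zero-zero = mk↔ₛ′ (λ _ → tt) (λ _ → [] , [ refl ]) (λ _ → refl) (λ { ([] , _) → refl })

  zero-suc : ∀ {k} → KSubset 0 (suc k) ↔ ⊥
  zero-suc = mk↔ₛ′ (λ { ([] , [ () ]) }) (λ ()) (λ ()) (λ { ([] , [ () ]) })

  suc-zero : ∀ {n} → KSubset (suc n) 0 ↔ KSubset n 0
  suc-zero = mk↔ₛ′
    (λ { (inside ∷ p , [ () ]) ; (outside ∷ p , [ eq ]) → p , [ eq ] })
    (λ { (p , [ eq ]) → outside ∷ p , [ eq ] })
    (λ _ → refl)
    (λ { (inside ∷ p , [ () ]) ; (outside ∷ p , [ eq ]) → refl })

  suc-suc : ∀ {n k} → KSubset (suc n) (suc k) ↔ (KSubset n k ⊎ KSubset n (suc k))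
  suc-suc = mk↔ₛ′
    (λ { (inside  ∷ p , [ eq ]) → inj₁ (p , [ suc-injective eq ])
       ; (outside ∷ p , [ eq ]) → inj₂ (p , [ eq ]) })
    (λ { (inj₁ (p , [ eq ])) → inside  ∷ p , [ cong suc eq ]
       ; (inj₂ (p , [ eq ])) → outside ∷ p , [ eq ] })
    (λ { (inj₁ _) → refl ; (inj₂ _) → refl })
    (λ { (inside ∷ p , _) → refl ; (outside ∷ p , _) → refl })

KSubset-finite : ∀ n k → ∃ λ m → KSubset n k ↔ Fin m
KSubset-finite zero    zero    = 1 , ↔-sym 1↔⊤ ↔-∘ zero-zero
KSubset-finite zero    (suc k) = 0 , ↔-sym 0↔⊥ ↔-∘ zero-suc
KSubset-finite (suc n) zero    with KSubset-finite n zero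
... | m , f = m , f ↔-∘ suc-zero
KSubset-finite (suc n) (suc k) with KSubset-finite n k | KSubset-finite n (suc k)
... | m₁ , f₁ | m₂ , f₂ = m₁ + m₂ , ↔-sym +↔⊎ ↔-∘ ((f₁ ⊎-↔ f₂) ↔-∘ suc-suc)

kSubsets : ∀ {a} → FiniteSet a → ℕ → FiniteSet _
kSubsets X k = record
  { Carrier = KSubset (FiniteSet.size X) k
  ; size    = proj₁ (KSubset-finite (FiniteSet.size X) k)
  ; finite  = proj₂ (KSubset-finite (FiniteSet.size X) k)
  }

-- Adjacency is required to be decidable, so that neighbourhoods are finite
-- subsets with a cardinality; classically this is no restriction.

record Graph {a} (V : FiniteSet a) (ℓ : Level) : Set (a ⊔ lsuc ℓ) where
  open FiniteSet V using (Carrier)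
  field
    Adj        : Carrier → Carrier → Set ℓ
    Adj?       : Decidable Adj
    Adj-sym    : Symmetric Adj
    Adj-irrefl : Irreflexive _≡_ Adj

-- Equality of two graphs on the same vertex set: same adjacent pairs.

infix 4 _≈ᴳ_
_≈ᴳ_ : ∀ {a ℓ₁ ℓ₂} {V : FiniteSet a} → Graph V ℓ₁ → Graph V ℓ₂ → Set (a ⊔ ℓ₁ ⊔ ℓ₂)
G ≈ᴳ H = ∀ u v → Graph.Adj G u v ⇔ Graph.Adj H u v

module _ {a ℓ} {V : FiniteSet a} (G : Graph V ℓ) where
  open FiniteSet V
  open Graph G

  N : Carrier → SubsetOf V
  N u = ⟦ V ⟧ (Adj? u)

  Admissible : Carrier → Carrier → Set a
  Admissible u v = u ≢ v × 5 ≤ ∣ N u ∩ N v ∣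

  Admissible? : Decidable Admissible
  Admissible? u v = ¬? (u ≟ v) ×-dec (5 ≤? ∣ N u ∩ N v ∣)

  Admissible-sym : Symmetric Admissible
  Admissible-sym {u} {v} (u≢v , 5≤) =
    (λ v≡u → u≢v (sym v≡u)) , subst (λ s → 5 ≤ ∣ s ∣) (∩-comm (N u) (N v)) 5≤

  IsEdge : SubsetOf V → Set (a ⊔ ℓ)
  IsEdge p = ∃₂ λ u v → Adj u v × p ≡ pair V u v

  IsEdge? : Decidable₁ IsEdge
  IsEdge? p = ∃? λ u → ∃? λ v → Adj? u v ×-dec ≡-dec Bool._≟_ p (pair V u v)

C : ∀ {a ℓ} {V : FiniteSet a} → Graph V ℓ → Graph V (a ⊔ ℓ)
C G = record
  { Adj        = λ u v → Adj u v ⊎ Admissible G u v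
  ; Adj?       = λ u v → Adj? u v ⊎-dec Admissible? G u v
  ; Adj-sym    = λ { (inj₁ uv) → inj₁ (Adj-sym uv)
                   ; (inj₂ uv) → inj₂ (Admissible-sym G uv) }
  ; Adj-irrefl = λ { u≡v (inj₁ uv) → Adj-irrefl u≡v uv
                   ; u≡v (inj₂ (u≢v , _)) → u≢v u≡v }
  }
  where open Graph G

F : ∀ {a ℓ} {V : FiniteSet a} (k : ℕ) → Graph V ℓ → Graph (kSubsets V k) (a ⊔ ℓ)
F {V = V} k G = record
  { Adj        = λ A B → IsEdge G (value A △ value B)
  ; Adj?       = λ A B → IsEdge? G (value A △ value B)
  ; Adj-sym    = λ {A} {B} → subst (IsEdge G) (△-comm (value A) (value B))
  ; Adj-irrefl = λ { {A} refl (u , v , _ , A△A≡uv) →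
      p△p-empty (value A)
        (subst (FiniteSet.index V u ∈_) (sym A△A≡uv) (x∈p∪q⁺ (inj₁ (x∈⁅x⁆ _)))) }
  }

{-# OPTIONS --safe #-}

-- For sets of equal size, A △ D = {x, y} says that D arises from A by trading an
-- element x for a new element y, or y for x.  Let A ≠ B have a common neighbour D
-- that trades x for y in A and p for q in B.  If x = p or y = q, then B arises
-- from A by a single trade of some u for some v.  In this situation the common
-- neighbours of A and B correspond bijectively to those of u and v: a vertex w ∉ A
-- yields A − u + w, a vertex w ∈ A yields A − w + v.  Otherwise |A △ B| = 4 and
-- every common neighbour trades an element of A ─ B for one of B ─ A; there are
-- only four such trades, fewer than five.

module Submission where

open import Defs
open import Data.Bool.Properties using () renaming (_≟_ to _≟ᵇ_)
open import Data.Fin using (Fin; zero; suc)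
open import Data.Fin.Properties using (suc-injective) renaming (_≟_ to _≟ᶠ_)
open import Data.Fin.Subset
  using (Subset; inside; outside; ⁅_⁆; ⊤; _∪_; _∩_; _-_; ∣_∣; _∈_; _⊆_; Nonempty)
open import Data.Fin.Subset.Properties
  using ( nonempty?; Empty-unique; ∣⊥∣≡0; ∣⊤∣≡n; ∈⊤; ⊆-antisym; x∈⁅x⁆; x∈⁅y⁆⇒x≡y; p⊂q⇒∣p∣<∣q∣
        ; x∈p∩q⁺; x∈p∩q⁻; x∈p∪q⁺; x∈p∪q⁻; x∈p∧x≢y⇒x∈p-y; x∈p⇒∣p-x∣<∣p∣)
open import Data.Irrelevant using ([_])
open import Data.Nat using (ℕ; suc; _≤_; _<_; z≤n; s≤s)
open import Data.Nat.Properties using (≤-trans; ≤-reflexive; <-irrefl; <⇒≢; <⇒≱; _≟_)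
open import Data.Product using (∃; ∃₂; _×_; _,_)
open import Data.Refinement using (_,_; value)
open import Data.Refinement.Properties using (value-injective)
open import Data.Sum using (_⊎_; inj₁; inj₂)
open import Data.Vec using ([]; _∷_; lookup; here; there; _[_]≔_)
open import Data.Vec.Properties
  using ([]=⇒lookup; lookup⇒[]=; lookup∘tabulate; lookup∘update; lookup∘update′)
open import Data.Vec.Relation.Binary.Pointwise.Extensional using (ext; Pointwise-≡⇒≡)
open import Function using (_∘_; mk⇔; Inverse)
open import Level using (Level; _⊔_)
open import Relation.Binary.PropositionalEquality
  using (_≡_; _≢_; refl; sym; trans; cong; subst; ≢-sym)
open import Relation.Nullary using (¬_; yes; no; does; contradiction; recompute)
open import Relation.Nullary.Decidable using (dec-true)
open import Relation.Unary using (Pred) renaming (Decidable to Decidable₁)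

private
  variable
    a b ℓ ℓ′ r : Level
    m n : ℕ

in≢out : ∀ {s} → s ≡ inside → s ≢ outside
in≢out refl ()

lookup-≢ : (p : Subset n) {i j : Fin n} → lookup p i ≡ inside → lookup p j ≡ outside → i ≢ j
lookup-≢ p i∈p i∉p refl = in≢out i∈p i∉p

∣p∣≤∣q∣-byRelation : (p : Subset m) (q : Subset n) (R : Fin m → Fin n → Set r) →
  (∀ {i} → i ∈ p → ∃ λ j → j ∈ q × R i j) →
  (∀ {i i′ j} → R i j → R i′ j → i ≡ i′) →
  ∣ p ∣ ≤ ∣ q ∣
∣p∣≤∣q∣-byRelation []            q R total inj = z≤n
∣p∣≤∣q∣-byRelation (outside ∷ p) q R total inj =
  ∣p∣≤∣q∣-byRelation p q (R ∘ suc) (total ∘ there) (λ s t → suc-injective (inj s t))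
∣p∣≤∣q∣-byRelation (inside ∷ p)  q R total inj with total here
... | j , j∈q , r₀ = ≤-trans
  (s≤s (∣p∣≤∣q∣-byRelation p (q - j) (R ∘ suc) total′ (λ s t → suc-injective (inj s t))))
  (x∈p⇒∣p-x∣<∣p∣ j∈q)
  where
  total′ : ∀ {i} → i ∈ p → ∃ λ j′ → j′ ∈ q - j × R (suc i) j′
  total′ i∈p with total (there i∈p)
  ... | j′ , j′∈q , r₁ =
    j′ , x∈p∧x≢y⇒x∈p-y j′∈q (λ { refl → contradiction (inj r₀ r₁) λ () }) , r₁

0<∣p∣⇒nonempty : (p : Subset n) → 0 < ∣ p ∣ → Nonempty p
0<∣p∣⇒nonempty {n} p 0<∣p∣ with nonempty? p
... | yes ne = ne
... | no ¬ne = contradiction 0<∣p∣ (<-irrefl (sym (trans (cong ∣_∣ (Empty-unique ¬ne)) (∣⊥∣≡0 n))))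

∣p[x]≔outside∣ : (p : Subset n) (x : Fin n) → lookup p x ≡ inside →
  suc ∣ p [ x ]≔ outside ∣ ≡ ∣ p ∣
∣p[x]≔outside∣ (inside  ∷ p) zero    refl = refl
∣p[x]≔outside∣ (inside  ∷ p) (suc x) x∈p  = cong suc (∣p[x]≔outside∣ p x x∈p)
∣p[x]≔outside∣ (outside ∷ p) (suc x) x∈p  = ∣p[x]≔outside∣ p x x∈p

∣p[x]≔inside∣ : (p : Subset n) (x : Fin n) → lookup p x ≡ outside →
  ∣ p [ x ]≔ inside ∣ ≡ suc ∣ p ∣
∣p[x]≔inside∣ (outside ∷ p) zero    refl = refl
∣p[x]≔inside∣ (inside  ∷ p) (suc x) x∉p  = cong suc (∣p[x]≔inside∣ p x x∉p)
∣p[x]≔inside∣ (outside ∷ p) (suc x) x∉p  = ∣p[x]≔inside∣ p x x∉p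

∈△⁺ : (p q : Subset n) {i : Fin n} → lookup p i ≢ lookup q i → i ∈ p △ q
∈△⁺ (inside  ∷ p) (inside  ∷ q) {zero}  i≢ = contradiction refl i≢
∈△⁺ (inside  ∷ p) (outside ∷ q) {zero}  i≢ = here
∈△⁺ (outside ∷ p) (inside  ∷ q) {zero}  i≢ = here
∈△⁺ (outside ∷ p) (outside ∷ q) {zero}  i≢ = contradiction refl i≢
∈△⁺ (_       ∷ p) (_       ∷ q) {suc i} i≢ = there (∈△⁺ p q i≢)

∈△⁻ : (p q : Subset n) {i : Fin n} → i ∈ p △ q → lookup p i ≢ lookup q i
∈△⁻ (inside  ∷ p) (outside ∷ q) {zero}  i∈         ()
∈△⁻ (outside ∷ p) (inside  ∷ q) {zero}  i∈         ()
∈△⁻ (_       ∷ p) (_       ∷ q) {suc i} (there i∈) = ∈△⁻ p q i∈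

∈pair⁻ : (x y : Fin n) {i : Fin n} → i ∈ ⁅ x ⁆ ∪ ⁅ y ⁆ → i ≡ x ⊎ i ≡ y
∈pair⁻ x y i∈ with x∈p∪q⁻ ⁅ x ⁆ ⁅ y ⁆ i∈
... | inj₁ i∈x = inj₁ (x∈⁅y⁆⇒x≡y x i∈x)
... | inj₂ i∈y = inj₂ (x∈⁅y⁆⇒x≡y y i∈y)

-- Trading x for y

record Swap (A D : Subset n) (x y : Fin n) : Set where
  field
    x∈A  : lookup A x ≡ inside
    y∉A  : lookup A y ≡ outside
    x∉D  : lookup D x ≡ outside
    y∈D  : lookup D y ≡ inside
    rest : ∀ {i} → i ≢ x → i ≢ y → lookup A i ≡ lookup D i

open Swap

module _ {A D : Subset n} where

  swap-reverse : ∀ {x y} → Swap A D x y → Swap D A y x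
  swap-reverse s = record
    { x∈A = y∈D s ; y∉A = x∉D s ; x∉D = y∉A s ; y∈D = x∈A s
    ; rest = λ i≢y i≢x → sym (rest s i≢x i≢y) }

  swap-source : ∀ {x y i} → Swap A D x y → lookup A i ≡ inside → lookup D i ≡ outside → i ≡ x
  swap-source {x} {y} {i} s i∈A i∉D with i ≟ᶠ x
  ... | yes i≡x = i≡x
  ... | no  i≢x =
    contradiction i∉D (in≢out (trans (sym (rest s i≢x (lookup-≢ A i∈A (y∉A s)))) i∈A))

  swap-target : ∀ {x y i} → Swap A D x y → lookup A i ≡ outside → lookup D i ≡ inside → i ≡ y
  swap-target {x} {y} {i} s i∉A i∈D with i ≟ᶠ y
  ... | yes i≡y = i≡y
  ... | no  i≢y =
    contradiction i∉A (in≢out (trans (rest s (≢-sym (lookup-≢ A (x∈A s) i∉A)) i≢y) i∈D))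

  swap-△ : ∀ {x y} → Swap A D x y → A △ D ≡ ⁅ x ⁆ ∪ ⁅ y ⁆
  swap-△ {x} {y} s = ⊆-antisym △⊆ ⊆△
    where
    △⊆ : A △ D ⊆ ⁅ x ⁆ ∪ ⁅ y ⁆
    △⊆ {i} i∈ with i ≟ᶠ x | i ≟ᶠ y
    ... | yes refl | _        = x∈p∪q⁺ (inj₁ (x∈⁅x⁆ i))
    ... | no _     | yes refl = x∈p∪q⁺ (inj₂ (x∈⁅x⁆ i))
    ... | no i≢x   | no i≢y   = contradiction (rest s i≢x i≢y) (∈△⁻ A D i∈)
    ⊆△ : ⁅ x ⁆ ∪ ⁅ y ⁆ ⊆ A △ D
    ⊆△ i∈ with ∈pair⁻ x y i∈
    ... | inj₁ refl = ∈△⁺ A D (λ eq → in≢out (x∈A s) (trans eq (x∉D s)))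
    ... | inj₂ refl = ∈△⁺ A D (λ eq → in≢out (y∈D s) (trans (sym eq) (y∉A s)))

swap-unique : {A D D′ : Subset n} {x y : Fin n} → Swap A D x y → Swap A D′ x y → D ≡ D′
swap-unique {D = D} {D′} {x} {y} s t = Pointwise-≡⇒≡ (ext agree)
  where
  agree : ∀ i → lookup D i ≡ lookup D′ i
  agree i with i ≟ᶠ x | i ≟ᶠ y
  ... | yes refl | _        = trans (x∉D s) (sym (x∉D t))
  ... | no _     | yes refl = trans (y∈D s) (sym (y∈D t))
  ... | no i≢x   | no i≢y   = trans (sym (rest s i≢x i≢y)) (rest t i≢x i≢y)

swap-exists : (A : Subset n) {x y : Fin n} → lookup A x ≡ inside → lookup A y ≡ outside →
  ∃ λ D → ∣ D ∣ ≡ ∣ A ∣ × Swap A D x y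
swap-exists A {x} {y} x∈ y∉ = A₁ [ y ]≔ inside
  , trans (∣p[x]≔inside∣ A₁ y (trans (lookup∘update′ (≢-sym x≢y) A outside) y∉))
      (∣p[x]≔outside∣ A x x∈)
  , record
    { x∈A = x∈ ; y∉A = y∉
    ; x∉D = trans (lookup∘update′ x≢y A₁ inside) (lookup∘update x A outside)
    ; y∈D = lookup∘update y A₁ inside
    ; rest = λ i≢x i≢y →
        sym (trans (lookup∘update′ i≢y A₁ inside) (lookup∘update′ i≢x A outside)) }
  where
  A₁ : Subset _
  A₁ = A [ x ]≔ outside
  x≢y : x ≢ y
  x≢y = lookup-≢ A x∈ y∉

module _ {A B D : Subset n} {u v w : Fin n} where

  swap-sameSource : Swap A B u v → Swap A D u w → v ≢ w → Swap B D v w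
  swap-sameSource s t v≢w = record
    { x∈A = y∈D s
    ; y∉A = trans (sym (rest s (≢-sym (lookup-≢ A (x∈A s) (y∉A t))) (≢-sym v≢w))) (y∉A t)
    ; x∉D = trans (sym (rest t (≢-sym (lookup-≢ A (x∈A s) (y∉A s))) v≢w)) (y∉A s)
    ; y∈D = y∈D t
    ; rest = rest′ }
    where
    rest′ : ∀ {i} → i ≢ v → i ≢ w → lookup B i ≡ lookup D i
    rest′ {i} i≢v i≢w with i ≟ᶠ u
    ... | yes refl = trans (x∉D s) (sym (x∉D t))
    ... | no i≢u   = trans (sym (rest s i≢u i≢v)) (rest t i≢u i≢w)

  swap-sameTarget : Swap A B u v → Swap A D w v → u ≢ w → Swap B D w u
  swap-sameTarget s t u≢w = record
    { x∈A = trans (sym (rest s (≢-sym u≢w) (lookup-≢ A (x∈A t) (y∉A s)))) (x∈A t)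
    ; y∉A = x∉D s
    ; x∉D = x∉D t
    ; y∈D = trans (sym (rest t u≢w (lookup-≢ A (x∈A s) (y∉A s)))) (x∈A s)
    ; rest = rest′ }
    where
    rest′ : ∀ {i} → i ≢ w → i ≢ u → lookup B i ≡ lookup D i
    rest′ {i} i≢w i≢u with i ≟ᶠ v
    ... | yes refl = trans (y∈D s) (sym (y∈D t))
    ... | no i≢v   = trans (sym (rest s i≢u i≢v)) (rest t i≢w i≢v)

△⇒swap : {A D : Subset n} {x y : Fin n} → ∣ A ∣ ≡ ∣ D ∣ → A △ D ≡ ⁅ x ⁆ ∪ ⁅ y ⁆ →
  Swap A D x y ⊎ Swap A D y x
△⇒swap {A = A} {D} {x} {y} ∣A∣≡∣D∣ eq = orient (differ (inj₁ refl)) (differ (inj₂ refl))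
  where
  differ : ∀ {i} → i ≡ x ⊎ i ≡ y → lookup A i ≢ lookup D i
  differ i≡ = ∈△⁻ A D (subst (_ ∈_) (sym eq) (x∈p∪q⁺ (singleton i≡)))
    where
    singleton : ∀ {i} → i ≡ x ⊎ i ≡ y → i ∈ ⁅ x ⁆ ⊎ i ∈ ⁅ y ⁆
    singleton (inj₁ refl) = inj₁ (x∈⁅x⁆ x)
    singleton (inj₂ refl) = inj₂ (x∈⁅x⁆ y)

  agree : ∀ {i} → i ≢ x → i ≢ y → lookup A i ≡ lookup D i
  agree {i} i≢x i≢y with lookup A i ≟ᵇ lookup D i
  ... | yes e = e
  ... | no ¬e with ∈pair⁻ x y (subst (i ∈_) eq (∈△⁺ A D ¬e))
  ...   | inj₁ i≡x = contradiction i≡x i≢x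
  ...   | inj₂ i≡y = contradiction i≡y i≢y

  smaller : (p q : Subset _) →
    (∀ {i} → i ≢ x → i ≢ y → lookup p i ≡ lookup q i) →
    lookup p x ≡ outside → lookup p y ≡ outside → lookup q x ≡ inside → ∣ p ∣ < ∣ q ∣
  smaller p q same x∉p y∉p x∈q = p⊂q⇒∣p∣<∣q∣
    ( (λ {i} i∈p → lookup⇒[]= i q (trans
        (sym (same (≢x i∈p x∉p) (≢x i∈p y∉p))) ([]=⇒lookup i∈p)))
    , x , lookup⇒[]= x q x∈q , λ x∈p → in≢out ([]=⇒lookup x∈p) x∉p )
    where
    ≢x : ∀ {i j} → i ∈ p → lookup p j ≡ outside → i ≢ j
    ≢x i∈p = lookup-≢ p ([]=⇒lookup i∈p)

  orient : lookup A x ≢ lookup D x → lookup A y ≢ lookup D y → Swap A D x y ⊎ Swap A D y x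
  orient x≢ y≢ with lookup A x in Ax | lookup D x in Dx | lookup A y in Ay | lookup D y in Dy
  ... | inside  | inside  | _       | _       = contradiction refl x≢
  ... | outside | outside | _       | _       = contradiction refl x≢
  ... | _       | _       | inside  | inside  = contradiction refl y≢
  ... | _       | _       | outside | outside = contradiction refl y≢
  ... | inside  | outside | outside | inside  = inj₁ record
    { x∈A = Ax ; y∉A = Ay ; x∉D = Dx ; y∈D = Dy ; rest = agree }
  ... | outside | inside  | inside  | outside = inj₂ record
    { x∈A = Ay ; y∉A = Ax ; x∉D = Dy ; y∈D = Dx ; rest = λ i≢y i≢x → agree i≢x i≢y }
  ... | inside  | outside | inside  | outside =
    contradiction (sym ∣A∣≡∣D∣) (<⇒≢ (smaller D A (λ i≢x i≢y → sym (agree i≢x i≢y)) Dx Dy Ax))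
  ... | outside | inside  | outside | inside  =
    contradiction ∣A∣≡∣D∣ (<⇒≢ (smaller A D agree Ax Ay Dx))

-- Sets D reachable by one trade from both A and B

-- With B = A − u + v, the two ways to obtain D: either the token misplaced by A
-- and B is moved on to w, or the token at w ∈ A ∩ B fills the gap.
Via : (A B : Subset n) (u v : Fin n) (D : Subset n) (w : Fin n) → Set
Via A B u v D w = (Swap A D u w × Swap B D v w) ⊎ (Swap A D w v × Swap B D w u)

via-unique : {A B D D′ : Subset n} {u v w : Fin n} →
  Via A B u v D w → Via A B u v D′ w → D ≡ D′
via-unique (inj₁ (s , _)) (inj₁ (t , _)) = swap-unique s t
via-unique (inj₂ (s , _)) (inj₂ (t , _)) = swap-unique s t
via-unique (inj₁ (s , _)) (inj₂ (t , _)) = contradiction (y∉A s) (in≢out (x∈A t))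
via-unique (inj₂ (s , _)) (inj₁ (t , _)) = contradiction (y∉A t) (in≢out (x∈A s))

via-injective : {A B D : Subset n} {u v w w′ : Fin n} →
  Via A B u v D w → Via A B u v D w′ → w ≡ w′
via-injective (inj₁ (s , _)) (inj₁ (t , _)) = swap-target t (y∉A s) (y∈D s)
via-injective (inj₂ (s , _)) (inj₂ (t , _)) = swap-source t (x∈A s) (x∉D s)
via-injective (inj₁ (s , _)) (inj₂ (_ , t)) = contradiction (x∉D s) (in≢out (y∈D t))
via-injective (inj₂ (_ , s)) (inj₁ (t , _)) = contradiction (x∉D t) (in≢out (y∈D s))

via-exists : {A B : Subset n} {u v w : Fin n} → Swap A B u v → w ≢ u → w ≢ v →
  ∃ λ D → ∣ D ∣ ≡ ∣ A ∣ × Via A B u v D w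
via-exists {A = A} {w = w} s w≢u w≢v with lookup A w in Aw
... | outside with swap-exists A (x∈A s) Aw
...   | D , ∣D∣ , t = D , ∣D∣ , inj₁ (t , swap-sameSource s t (≢-sym w≢v))
via-exists {A = A} {w = w} s w≢u w≢v | inside with swap-exists A Aw (y∉A s)
...   | D , ∣D∣ , t = D , ∣D∣ , inj₂ (t , swap-sameTarget s t (≢-sym w≢u))

record Far (A B D : Subset n) (x y p q : Fin n) : Set where
  field
    toA : Swap A D x y
    toB : Swap B D p q
    x≢p : x ≢ p
    y≢q : y ≢ q

module _ {A B D : Subset n} {x y p q : Fin n} (f : Far A B D x y p q) where
  open Far f

  far-x∉B : lookup B x ≡ outside
  far-x∉B = trans (rest toB x≢p (≢-sym (lookup-≢ D (y∈D toB) (x∉D toA)))) (x∉D toA)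

  far-y∈B : lookup B y ≡ inside
  far-y∈B = trans (rest toB (lookup-≢ D (y∈D toA) (x∉D toB)) y≢q) (y∈D toA)

  far-q∈A : lookup A q ≡ inside
  far-q∈A = trans (rest toA (lookup-≢ D (y∈D toB) (x∉D toA)) (≢-sym y≢q)) (y∈D toB)

  far-source : ∀ {i} → lookup A i ≡ inside → lookup B i ≡ outside → i ≡ x ⊎ i ≡ q
  far-source {i} i∈A i∉B with i ≟ᶠ x
  ... | yes i≡x = inj₁ i≡x
  ... | no  i≢x = inj₂ (swap-target toB i∉B
    (trans (sym (rest toA i≢x (lookup-≢ A i∈A (y∉A toA)))) i∈A))

  far-target : ∀ {i} → lookup A i ≡ outside → lookup B i ≡ inside → i ≡ y ⊎ i ≡ p
  far-target {i} i∉A i∈B with i ≟ᶠ y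
  ... | yes i≡y = inj₁ i≡y
  ... | no  i≢y = inj₂ (swap-source toB i∈B
    (trans (sym (rest toA (≢-sym (lookup-≢ A (x∈A toA) i∉A)) i≢y)) i∉A))

  far⇒¬swap : ∀ {u v} → ¬ Swap A B u v
  far⇒¬swap s = lookup-≢ D (y∈D toB) (x∉D toA)
    (trans (swap-source s far-q∈A (y∉A toB)) (sym (swap-source s (x∈A toA) far-x∉B)))

far-fourTrades : {A B D D′ : Subset n} {x y p q x′ y′ p′ q′ : Fin n} →
  Far A B D x y p q → Far A B D′ x′ y′ p′ q′ →
  ∃ λ (j : Fin 4) → Swap A D′ (lookup (x ∷ x ∷ q ∷ q ∷ []) j) (lookup (y ∷ p ∷ y ∷ p ∷ []) j)
far-fourTrades f g
  with far-source f (x∈A (Far.toA g)) (far-x∉B g) | far-target f (y∉A (Far.toA g)) (far-y∈B g)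
... | inj₁ refl | inj₁ refl = zero , Far.toA g
... | inj₁ refl | inj₂ refl = suc zero , Far.toA g
... | inj₂ refl | inj₁ refl = suc (suc zero) , Far.toA g
... | inj₂ refl | inj₂ refl = suc (suc (suc zero)) , Far.toA g

-- Neighbourhoods and token graphs

module _ (V : FiniteSet a) where
  open FiniteSet V using (Carrier; element; index; element-index)

  index-injective : ∀ {u v} → index u ≡ index v → u ≡ v
  index-injective {u} {v} eq =
    trans (sym (element-index u)) (trans (cong element eq) (element-index v))

  element-injective : ∀ {i j} → element i ≡ element j → i ≡ j
  element-injective {i} {j} eq =
    trans (sym (index-element i)) (trans (cong index eq) (index-element j))
    where open Inverse (FiniteSet.finite V) renaming (strictlyInverseˡ to index-element)

  module _ {P : Pred Carrier r} (P? : Decidable₁ P) where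

    ∈⟦⟧⁻ : ∀ {i} → i ∈ ⟦ V ⟧ P? → P (element i)
    ∈⟦⟧⁻ {i} i∈ with P? (element i)
                   | trans (sym (lookup∘tabulate (does ∘ P? ∘ element) i)) ([]=⇒lookup i∈)
    ... | yes Pi | _ = Pi

    ∈⟦⟧⁺ : ∀ {x} → P x → index x ∈ ⟦ V ⟧ P?
    ∈⟦⟧⁺ {x} Px = lookup⇒[]= (index x) _ (trans
      (lookup∘tabulate (does ∘ P? ∘ element) (index x))
      (dec-true (P? _) (subst P (sym (element-index x)) Px)))

module _ {V : FiniteSet a} (G : Graph V ℓ) where
  open FiniteSet V using (element)
  open Graph G

  ∈N∩N⁻ : ∀ u v {i} → i ∈ N G u ∩ N G v → Adj u (element i) × Adj v (element i)
  ∈N∩N⁻ u v i∈ with x∈p∩q⁻ (N G u) (N G v) i∈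
  ... | i∈u , i∈v = ∈⟦⟧⁻ V (Adj? u) i∈u , ∈⟦⟧⁻ V (Adj? v) i∈v

  Adj⇒≢ : ∀ {u v} → Adj u v → u ≢ v
  Adj⇒≢ uv u≡v = Adj-irrefl u≡v uv

module _ {V : FiniteSet a} {W : FiniteSet b} (G : Graph V ℓ) (H : Graph W ℓ′) where
  private
    module V = FiniteSet V
    module W = FiniteSet W
    module G = Graph G
    module H = Graph H

  ∣N∩N∣-mono : ∀ u v u′ v′ (R : V.Carrier → W.Carrier → Set r) →
    (∀ w → G.Adj u w → G.Adj v w → ∃ λ w′ → (H.Adj u′ w′ × H.Adj v′ w′) × R w w′) →
    (∀ {x y w′} → R x w′ → R y w′ → x ≡ y) →
    ∣ N G u ∩ N G v ∣ ≤ ∣ N H u′ ∩ N H v′ ∣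
  ∣N∩N∣-mono u v u′ v′ R total inj =
    ∣p∣≤∣q∣-byRelation _ _ (λ i j → R (V.element i) (W.element j)) total′
      (λ s t → element-injective V (inj s t))
    where
    total′ : ∀ {i} → i ∈ N G u ∩ N G v →
      ∃ λ j → j ∈ N H u′ ∩ N H v′ × R (V.element i) (W.element j)
    total′ i∈ with ∈N∩N⁻ G u v i∈
    ... | ui , vi with total _ ui vi
    ...   | w′ , (uw′ , vw′) , r₀ =
      W.index w′ , x∈p∩q⁺ (∈⟦⟧⁺ W (H.Adj? u′) uw′ , ∈⟦⟧⁺ W (H.Adj? v′) vw′)
      , subst (R _) (sym (W.element-index w′)) r₀

module _ (V : FiniteSet a) (k : ℕ) where
  open FiniteSet V using (index; size)

  Move : KSubset size k → KSubset size k → FiniteSet.Carrier V → FiniteSet.Carrier V → Set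
  Move A B u v = Swap (value A) (value B) (index u) (index v)

  kSubset-size : (A : KSubset size k) → ∣ value A ∣ ≡ k
  kSubset-size (_ , [ eq ]) = recompute (_ ≟ _) eq

  module _ (G : Graph V ℓ) where
    open Graph G

    edge⇒move : ∀ A B → IsEdge G (value A △ value B) → ∃₂ λ u v → Adj u v × Move A B u v
    edge⇒move A B (u , v , uv , eq)
      with △⇒swap {A = value A} {value B} (trans (kSubset-size A) (sym (kSubset-size B))) eq
    ... | inj₁ s = u , v , uv , s
    ... | inj₂ s = v , u , Adj-sym uv , s

    move⇒edge : ∀ A B {u v} → Adj u v → Move A B u v → IsEdge G (value A △ value B)
    move⇒edge A B uv s = _ , _ , uv , swap-△ s

module _ {V : FiniteSet a} (G : Graph V ℓ) (k : ℕ) where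
  open FiniteSet V using (index; size) renaming (_≟_ to _≟ⱽ_)
  open Graph G
  private
    FG = F k G
    module FV = FiniteSet (kSubsets V k)

  data CommonNeighbour (A B D : KSubset size k) : Set (a ⊔ ℓ) where
    near : ∀ {u v w} → Adj u w → Adj v w → Move V k A B u v →
      Via (value A) (value B) (index u) (index v) (value D) (index w) → CommonNeighbour A B D
    far : ∀ {x y p q} → Far (value A) (value B) (value D) x y p q → CommonNeighbour A B D

  commonNeighbour : ∀ A B D → A ≢ B → Graph.Adj FG A D → Graph.Adj FG B D →
    CommonNeighbour A B D
  commonNeighbour A B D A≢B AD BD with edge⇒move V k G A D AD | edge⇒move V k G B D BD
  ... | x , y , xy , s | p , q , pq , t with x ≟ⱽ p | y ≟ⱽ q
  ... | yes refl | yes refl =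
    contradiction (value-injective (swap-unique (swap-reverse s) (swap-reverse t))) A≢B
  ... | no x≢p   | yes refl = near xy pq
    (swap-sameSource (swap-reverse s) (swap-reverse t) (x≢p ∘ index-injective V)) (inj₁ (s , t))
  ... | yes refl | no y≢q   = near (Adj-sym pq) (Adj-sym xy)
    (swap-sameTarget (swap-reverse s) (swap-reverse t) (y≢q ∘ index-injective V)) (inj₂ (s , t))
  ... | no x≢p   | no y≢q   = far record
    { toA = s ; toB = t ; x≢p = x≢p ∘ index-injective V ; y≢q = y≢q ∘ index-injective V }

  moves-agree : ∀ A B {u v u′ v′} → Move V k A B u v → Move V k A B u′ v′ →
    u ≡ u′ × v ≡ v′
  moves-agree _ _ s t = index-injective V (swap-source t (x∈A s) (x∉D s))
                      , index-injective V (swap-target t (y∉A s) (y∈D s))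

  move⇒≢ : ∀ A B {u v} → Move V k A B u v → A ≢ B
  move⇒≢ _ _ s refl = in≢out (x∈A s) (x∉D s)

  module _ (A B : KSubset size k) {u v : FiniteSet.Carrier V} (s : Move V k A B u v) where

    private
      R : KSubset size k → FiniteSet.Carrier V → Set
      R D w = Via (value A) (value B) (index u) (index v) (value D) (index w)

    tokens≤vertices : ∣ N FG A ∩ N FG B ∣ ≤ ∣ N G u ∩ N G v ∣
    tokens≤vertices = ∣N∩N∣-mono FG G A B u v R total
      (λ r t → value-injective (via-unique r t))
      where
      total : ∀ D → Graph.Adj FG A D → Graph.Adj FG B D → ∃ λ w → (Adj u w × Adj v w) × R D w
      total D AD BD with commonNeighbour A B D (move⇒≢ A B s) AD BD
      ... | far f = contradiction s (far⇒¬swap f)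
      ... | near uw vw s′ via with moves-agree A B s s′
      ...   | refl , refl = _ , (uw , vw) , via

    vertices≤tokens : ∣ N G u ∩ N G v ∣ ≤ ∣ N FG A ∩ N FG B ∣
    vertices≤tokens = ∣N∩N∣-mono G FG u v A B (λ w D → R D w) total
      (λ r t → index-injective V (via-injective r t))
      where
      edges : ∀ D {w} → Adj u w → Adj v w → R D w → Graph.Adj FG A D × Graph.Adj FG B D
      edges D uw vw (inj₁ (s₁ , s₂)) = move⇒edge V k G A D uw s₁ , move⇒edge V k G B D vw s₂
      edges D uw vw (inj₂ (s₁ , s₂)) =
        move⇒edge V k G A D (Adj-sym vw) s₁ , move⇒edge V k G B D (Adj-sym uw) s₂
      total : ∀ w → Adj u w → Adj v w → ∃ λ D → (Graph.Adj FG A D × Graph.Adj FG B D) × R D w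
      total w uw vw
        with via-exists s (≢-sym (Adj⇒≢ G uw) ∘ index-injective V)
                          (≢-sym (Adj⇒≢ G vw) ∘ index-injective V)
      ... | D , ∣D∣ , via = D′ , edges D′ uw vw via , via
        where
        D′ : KSubset size k
        D′ = D , [ trans ∣D∣ (kSubset-size V k A) ]

  far⇒∣N∩N∣≤4 : ∀ A B {D x y p q} → Far (value A) (value B) D x y p q →
    ∣ N FG A ∩ N FG B ∣ ≤ 4
  far⇒∣N∩N∣≤4 A B {x = x} {y} {p} {q} f = ≤-trans
    (∣p∣≤∣q∣-byRelation (N FG A ∩ N FG B) ⊤
      (λ i j → Swap (value A) (value (FV.element i))
        (lookup (x ∷ x ∷ q ∷ q ∷ []) j) (lookup (y ∷ p ∷ y ∷ p ∷ []) j))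
      total
      (λ s t → element-injective (kSubsets V k) (value-injective (swap-unique s t))))
    (≤-reflexive (∣⊤∣≡n 4))
    where
    A≢B : value A ≢ value B
    A≢B eq = in≢out (x∈A (Far.toA f)) (trans (cong (λ c → lookup c x) eq) (far-x∉B f))
    total : ∀ {i} → i ∈ N FG A ∩ N FG B → ∃ λ (j : Fin 4) → j ∈ ⊤ ×
      Swap (value A) (value (FV.element i))
        (lookup (x ∷ x ∷ q ∷ q ∷ []) j) (lookup (y ∷ p ∷ y ∷ p ∷ []) j)
    total {i} i∈ with ∈N∩N⁻ FG A B i∈
    ... | AD , BD with commonNeighbour A B (FV.element i) (A≢B ∘ cong value) AD BD
    ...   | near _ _ s _ = contradiction s (far⇒¬swap f)
    ...   | far g with far-fourTrades f g
    ...     | j , t = j , ∈⊤ , t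

  admissibleTokens⇒move : ∀ A B → Admissible FG A B →
    ∃₂ λ u v → Admissible G u v × Move V k A B u v
  admissibleTokens⇒move A B (A≢B , 5≤)
    with 0<∣p∣⇒nonempty (N FG A ∩ N FG B) (≤-trans (s≤s z≤n) 5≤)
  ... | i , i∈ with ∈N∩N⁻ FG A B i∈
  ...   | AD , BD with commonNeighbour A B (FV.element i) A≢B AD BD
  ...     | far f = contradiction 5≤ (<⇒≱ (s≤s (far⇒∣N∩N∣≤4 A B f)))
  ...     | near {u} {v} _ _ s _ = u , v
    , ((λ { refl → in≢out (x∈A s) (y∉A s) }) , ≤-trans 5≤ (tokens≤vertices A B s)) , s

  admissible⇒admissibleTokens : ∀ A B {u v} → Admissible G u v → Move V k A B u v →
    Admissible FG A B
  admissible⇒admissibleTokens A B (_ , 5≤) s =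
    move⇒≢ A B s , ≤-trans 5≤ (vertices≤tokens A B s)

lemma1 : ∀ {a ℓ : Level} {V : FiniteSet a} (G : Graph V ℓ) (k : ℕ) →
    1 ≤ k → k < FiniteSet.size V → C (F k G) ≈ᴳ F k (C G)
lemma1 {V = V} G k _ _ A B = mk⇔ ⊆ᴳ ⊇ᴳ
  where
  ⊆ᴳ : Graph.Adj (C (F k G)) A B → Graph.Adj (F k (C G)) A B
  ⊆ᴳ (inj₁ (u , v , uv , eq)) = u , v , inj₁ uv , eq
  ⊆ᴳ (inj₂ AB) =
    let u , v , uv , s = admissibleTokens⇒move G k A B AB
    in  move⇒edge V k (C G) A B (inj₂ uv) s

  ⊇ᴳ : Graph.Adj (F k (C G)) A B → Graph.Adj (C (F k G)) A B
  ⊇ᴳ AB with edge⇒move V k (C G) A B AB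
  ... | u , v , inj₁ uv , s = inj₁ (move⇒edge V k G A B uv s)
  ... | u , v , inj₂ uv , s = inj₂ (admissible⇒admissibleTokens G k A B uv s)
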